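{- For every $n \geq 1$, the mixed separated number of $K_{n,n}$ equals $\lceil \frac{2n}{3} \rceil$.
   Context: Let $K_{n,n}$ have parts $U=\{u_0,\ldots,u_{n-1}\}$ and $V=\{v_0,\ldots,v_{n-1}\}$. A vertex order is separated if all vertices of one part precede all vertices of the other part. Given a total vertex order $\prec$, two edges $(a_1,b_1)$, $(a_2,b_2)$ with four distinct endpoints and $a_1\prec b_1$, $a_2 \prec b_2$, $a_1 \prec a_2$ are said to cross if $a_1 \prec a_2 \prec b_1 \prec b_2$, and to nest if $a_1 \prec a_2 \prec b_2 \prec b_1$. A stack is a set of edges no two of which cross; a queue is a set of edges no two of which nest. The mixed separated number of $K_{n,n}$ is the minimum $s+q$ such that there is a separated vertex order of $K_{n,n}$ and a partition of its edges into $s$ stacks and $q$ queues with respect to that order. -}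

module Defs where

open import Data.Nat using (ℕ; _+_; _*_; _<_; _≤_; _⊓_; _⊔_)
open import Data.Nat.DivMod using (_/_)
open import Data.Fin using (Fin)
open import Data.Sum using (_⊎_; inj₁; inj₂)
open import Data.Product using (Σ; _×_; _,_; proj₁; proj₂)
open import Relation.Binary.PropositionalEquality using (_≡_; _≢_)
open import Relation.Nullary using (¬_)
open import Function.Definitions using (Injective)

-- Vertices of K_{n,n}: inj₁ i is u_i ∈ U, inj₂ j is v_j ∈ V.
Vertex : ℕ → Set
Vertex n = Fin n ⊎ Fin n

-- Edges of K_{n,n}: (i , j) is the edge u_i v_j (every such pair is an edge).
Edge : ℕ → Set
Edge n = Fin n × Fin n

-- A total vertex order is given by an injective ranking pos : Vertex n → ℕ
-- (x ≺ y iff pos x < pos y). Every total order on the finite vertex set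
-- arises this way and crossing/nesting only depend on the induced order.
Order : ℕ → Set
Order n = Vertex n → ℕ

IsTotalOrder : ∀ {n} → Order n → Set
IsTotalOrder pos = Injective _≡_ _≡_ pos

Separated : ∀ {n} → Order n → Set
Separated {n} pos =
  ((i j : Fin n) → pos (inj₁ i) < pos (inj₂ j)) ⊎
  ((i j : Fin n) → pos (inj₂ j) < pos (inj₁ i))

left right : ∀ {n} → Order n → Edge n → ℕ
left  pos (i , j) = pos (inj₁ i) ⊓ pos (inj₂ j)
right pos (i , j) = pos (inj₁ i) ⊔ pos (inj₂ j)

DistinctEnds : ∀ {n} → Edge n → Edge n → Set
DistinctEnds (i , j) (i' , j') = i ≢ i' × j ≢ j'

CrossOrdered : ∀ {n} → Order n → Edge n → Edge n → Set
CrossOrdered pos e f =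
  left pos e < left pos f × left pos f < right pos e × right pos e < right pos f

NestOrdered : ∀ {n} → Order n → Edge n → Edge n → Set
NestOrdered pos e f =
  left pos e < left pos f × left pos f < right pos f × right pos f < right pos e

Cross : ∀ {n} → Order n → Edge n → Edge n → Set
Cross pos e f = DistinctEnds e f × (CrossOrdered pos e f ⊎ CrossOrdered pos f e)

Nest : ∀ {n} → Order n → Edge n → Edge n → Set
Nest pos e f = DistinctEnds e f × (NestOrdered pos e f ⊎ NestOrdered pos f e)

-- A partition of the edges into s stacks and q queues: each edge gets exactly
-- one class, inj₁ k (stack k) or inj₂ k (queue k).
ValidStacksQueues : ∀ {n s q} → Order n → (Edge n → Fin s ⊎ Fin q) → Set
ValidStacksQueues {n} {s} {q} pos c =
  ((k : Fin s) (e f : Edge n) → c e ≡ inj₁ k → c f ≡ inj₁ k → ¬ Cross pos e f) ×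
  ((k : Fin q) (e f : Edge n) → c e ≡ inj₂ k → c f ≡ inj₂ k → ¬ Nest pos e f)

HasSeparatedMixedLayout : ℕ → ℕ → ℕ → Set
HasSeparatedMixedLayout n s q =
  Σ (Order n) λ pos → IsTotalOrder pos × Separated pos ×
    Σ (Edge n → Fin s ⊎ Fin q) λ c → ValidStacksQueues pos c

IsMixedSeparatedNumber : ℕ → ℕ → Set
IsMixedSeparatedNumber n m =
  (Σ ℕ λ s → Σ ℕ λ q → s + q ≡ m × HasSeparatedMixedLayout n s q) ×
  ((s q : ℕ) → HasSeparatedMixedLayout n s q → m ≤ s + q)

⌈_/3⌉ : ℕ → ℕ
⌈ m /3⌉ = (m + 2) / 3

{-# OPTIONS --safe #-}

-- Sorting both parts turns K_{n,n} into an n × n grid in which a stack contains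
-- no two strictly increasing cells and a queue no two strictly decreasing ones.
--
-- Lower bound.  Let f(x,y) be the length of a longest strictly increasing chain
-- of stack cells in [0,x) × [0,y), and g(x,y) that of a longest strictly
-- decreasing chain of queue cells in [0,x) × [y,n).  On a unit cell let a and b
-- be the increments of f and g along the two diagonals.  Both are 0 or 1 and
-- a + b − a b = 1, while a b bounds the area of the image of the cell under
-- (f , g).  Summing 1 ≤ a + b − area over all cells, everything telescopes to
-- the boundary of the grid and, writing n = s + r + q, leaves r² ≤ s q.  Hence
-- 2 r ≤ s + q, that is, 2 n ≤ 3 (s + q).
--
-- Upper bound.  A pinwheel of blocks splits a (2q + s) × (2s + q) grid into q
-- increasing and s decreasing staircase paths; s and q are taken as equal as
-- possible.

module Submission where

open import Defs
open import Data.Fin as Fin using (Fin; toℕ; fromℕ<; punchIn; opposite; zero; suc)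
open import Data.Maybe using (Maybe; just; nothing)
open import Data.Product using (Σ; _×_; _,_; proj₁; proj₂; ∃)
open import Data.Sum using (_⊎_; inj₁; inj₂; isInj₁; isInj₂)
open import Data.Sum.Properties using (inj₁-injective; inj₂-injective)
open import Function.Base using (_∘_)
open import Function.Definitions using (Injective)
open import Relation.Binary.PropositionalEquality
open import Relation.Nullary using (¬_; Dec; yes; no; contradiction)

-- Upper bound: colouring the grid by the pinwheel of staircases.

module UpperBound where

  open import Data.Nat
  open import Data.Nat.Properties
  open import Data.Nat.DivMod
  open import Data.Nat.Tactic.RingSolver using (solve-∀)
  import Data.Fin.Properties as Fin

  -- Cut the rows into blocks of heights q, s, q and the columns into blocks of
  -- widths s, q, s, with p = s + q.  The queues run right through the two upper
  -- left blocks, down through the central one and right through the two lower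
  -- right ones; the stacks fill the remaining four blocks, which form the same
  -- figure after a quarter turn with s and q exchanged.
  data Strip (q s p i j : ℕ) : Set where
    top    : i < q → j < p → Strip q s p i j
    bottom : q ≤ i → s ≤ j → (p ≤ i ⊎ j < p) → Strip q s p i j

  -- Path `t` runs right along row `t` to column `p ∸ suc t`, down that column to row `p + t`, and
  -- right along that row. The minimum describes the first corner, the truncated maximum the second.
  path : ∀ {q s p i j} → Strip q s p i j → ℕ
  path {p = p} {i} {j} (top _ _)      = i ⊓ (p ∸ suc j)
  path {p = p} {i} {j} (bottom _ _ _) = (i ∸ p) ⊔ (p ∸ suc j)

  ∸-suc-anti-< : ∀ {p j j'} → j' < j → j < p → p ∸ suc j < p ∸ suc j'
  ∸-suc-anti-< j'<j j<p = ∸-monoʳ-< (s≤s j'<j) j<p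

  -- Up to truncation both `i` and `p ∸ suc j` grow when the row goes up and the column goes down.
  -- Cells of equal index therefore never form a strictly decreasing pair.
  path-mono-< : ∀ {q s p i j i' j'} (R : Strip q s p i j) (R' : Strip q s p i' j') →
                i < i' → j' < j → path R < path R'
  path-mono-< (top _ j<p) (top _ _) i<i' j'<j = ⊓-mono-< i<i' (∸-suc-anti-< j'<j j<p)
  path-mono-< {p = p} {i} {j} {i'} {j'} (top _ j<p) (bottom _ _ _) i<i' j'<j = begin-strict
    i ⊓ (p ∸ suc j)          ≤⟨ m⊓n≤n i _ ⟩
    p ∸ suc j                <⟨ ∸-suc-anti-< j'<j j<p ⟩
    p ∸ suc j'               ≤⟨ m≤n⊔m (i' ∸ p) _ ⟩
    (i' ∸ p) ⊔ (p ∸ suc j')  ∎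
    where open ≤-Reasoning
  path-mono-< (bottom q≤i _ _) (top i'<q _) i<i' _ =
    contradiction (<-trans i<i' i'<q) (≤⇒≯ q≤i)
  path-mono-< {p = p} {i} {j} {i'} {j'} (bottom _ _ _) (bottom _ _ _) i<i' j'<j
    with p ≤? i | j <? p
  -- A term truncated to 0 need not grow, and then the other one has to. The last field of `bottom`
  -- rules out that both are truncated at the first cell.
  ... | yes p≤i | yes j<p = ⊔-mono-< (∸-monoˡ-< i<i' p≤i) (∸-suc-anti-< j'<j j<p)
  ... | yes p≤i | no j≮p rewrite m≤n⇒m∸n≡0 (m≤n⇒m≤1+n (≮⇒≥ j≮p)) | ⊔-identityʳ (i ∸ p) =
    <-≤-trans (∸-monoˡ-< i<i' p≤i) (m≤m⊔n (i' ∸ p) _)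
  ... | no p≰i | yes j<p rewrite m≤n⇒m∸n≡0 (<⇒≤ (≰⇒> p≰i)) =
    <-≤-trans (∸-suc-anti-< j'<j j<p) (m≤n⊔m (i' ∸ p) _)
  path-mono-< (bottom _ _ (inj₁ p≤i)) (bottom _ _ _) _ _ | no p≰i | no _ = contradiction p≤i p≰i
  path-mono-< (bottom _ _ (inj₂ j<p)) (bottom _ _ _) _ _ | no _ | no j≮p = contradiction j<p j≮p

  path<q : ∀ {q s p i j} (R : Strip q s p i j) → p ≤ s + q → i < p + q → path R < q
  path<q {i = i} (top i<q _) _ _ = ≤-<-trans (m⊓n≤m i _) i<q
  path<q {zero} {p = p} (bottom _ _ (inj₁ p≤i)) _ i<p+q =
    contradiction (subst (_ <_) (+-identityʳ p) i<p+q) (≤⇒≯ p≤i)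
  path<q {zero} {s} (bottom _ s≤j (inj₂ j<p)) p≤s+q _ =
    contradiction (≤-trans j<p (subst (_ ≤_) (+-identityʳ s) p≤s+q)) (≤⇒≯ s≤j)
  path<q {q@(suc _)} {s} {p} {i} {j} (bottom _ s≤j _) p≤s+q i<p+q =
    ⊔-pres-<m (m<n+o⇒m∸n<o i p i<p+q)
              (m<n+o⇒m∸n<o p (suc j) (s≤s (≤-trans p≤s+q (+-monoˡ-≤ q s≤j))))

  -- The quarter turn sends row `i`, column `j` to row `s + (s + q) ∸ suc j`, column `i`. It makes
  -- strictly increasing pairs strictly decreasing, so `path-mono-<` serves the stacks as well.
  strip-or-rotated : ∀ q s i j → j < s + (s + q) →
    Strip q s (s + q) i j ⊎ Strip s q (s + q) (s + (s + q) ∸ suc j) i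
  strip-or-rotated q s i j j<w = split (i <? q) (j <? s) (i <? p) (j <? p)
    where
    open ≤-Reasoning
    p = s + q

    right-columns : p ≤ j → s + p ∸ suc j < s
    right-columns p≤j = begin-strict
      s + p ∸ suc j  <⟨ ∸-monoʳ-< (s≤s p≤j) j<w ⟩
      s + p ∸ p      ≡⟨ m+n∸n≡m s p ⟩
      s              ∎

    left-columns : j < s → p ≤ s + p ∸ suc j
    left-columns j<s = begin
      p              ≡⟨ m+n∸m≡n s p ⟨
      s + p ∸ s      ≤⟨ ∸-monoʳ-≤ (s + p) j<s ⟩
      s + p ∸ suc j  ∎

    split : Dec (i < q) → Dec (j < s) → Dec (i < p) → Dec (j < p) →
            Strip q s p i j ⊎ Strip s q p (s + p ∸ suc j) i
    split (yes i<q) _ _ (yes j<p) = inj₁ (top i<q j<p)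
    split (yes i<q) _ _ (no j≮p)  = inj₂ (top (right-columns (≮⇒≥ j≮p)) (m≤n⇒m≤o+n s i<q))
    split (no i≮q) (yes j<s) _ _  =
      inj₂ (bottom (≤-trans (m≤m+n s q) (left-columns j<s)) (≮⇒≥ i≮q) (inj₁ (left-columns j<s)))
    split (no i≮q) (no j≮s) _ (yes j<p) = inj₁ (bottom (≮⇒≥ i≮q) (≮⇒≥ j≮s) (inj₂ j<p))
    split _ _ (yes i<p) (no j≮p) = inj₂ (top (right-columns (≮⇒≥ j≮p)) i<p)
    split (no i≮q) (no j≮s) (no i≮p) _ = inj₁ (bottom (≮⇒≥ i≮q) (≮⇒≥ j≮s) (inj₁ (≮⇒≥ i≮p)))

  module Layout (n s q : ℕ) (n≤rows : n ≤ s + q + q) (n≤columns : n ≤ s + (s + q)) where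

    pos : Order n
    pos (inj₁ i) = toℕ i
    pos (inj₂ j) = n + toℕ j

    U≺V : ∀ i j → pos (inj₁ i) < pos (inj₂ j)
    U≺V i j = <-≤-trans (Fin.toℕ<n i) (m≤m+n n (toℕ j))

    pos-injective : IsTotalOrder pos
    pos-injective {inj₁ i} {inj₁ i'} eq = cong inj₁ (Fin.toℕ-injective eq)
    pos-injective {inj₁ i} {inj₂ j}  eq = contradiction eq (<⇒≢ (U≺V i j))
    pos-injective {inj₂ j} {inj₁ i}  eq = contradiction (sym eq) (<⇒≢ (U≺V i j))
    pos-injective {inj₂ j} {inj₂ j'} eq = cong inj₂ (Fin.toℕ-injective (+-cancelˡ-≡ n _ _ eq))

    left-pos : ∀ e → left pos e ≡ toℕ (proj₁ e)
    left-pos (i , j) = m≤n⇒m⊓n≡m (<⇒≤ (U≺V i j))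

    right-pos : ∀ e → right pos e ≡ n + toℕ (proj₂ e)
    right-pos (i , j) = m≤n⇒m⊔n≡n (<⇒≤ (U≺V i j))

    left<⇒row< : ∀ e f → left pos e < left pos f → toℕ (proj₁ e) < toℕ (proj₁ f)
    left<⇒row< e f = subst₂ _<_ (left-pos e) (left-pos f)

    right<⇒column< : ∀ e f → right pos e < right pos f → toℕ (proj₂ e) < toℕ (proj₂ f)
    right<⇒column< e f e<f = +-cancelˡ-< n _ _ (subst₂ _<_ (right-pos e) (right-pos f) e<f)

    QueueCell StackCell : Edge n → Set
    QueueCell (i , j) = Strip q s (s + q) (toℕ i) (toℕ j)
    StackCell (i , j) = Strip s q (s + q) (s + (s + q) ∸ suc (toℕ j)) (toℕ i)

    column< : ∀ j → toℕ {n} j < s + (s + q)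
    column< j = <-≤-trans (Fin.toℕ<n j) n≤columns

    class : ∀ e → QueueCell e ⊎ StackCell e → Fin s ⊎ Fin q
    class (i , j) (inj₁ R) =
      inj₂ (fromℕ< (path<q R ≤-refl (<-≤-trans (Fin.toℕ<n i) n≤rows)))
    class (i , j) (inj₂ R) =
      inj₁ (fromℕ< (path<q R (≤-reflexive (+-comm s q)) rotated-row<))
      where
      rotated-row< : s + (s + q) ∸ suc (toℕ j) < s + q + s
      rotated-row< = subst (s + (s + q) ∸ suc (toℕ j) <_) (+-comm s (s + q))
                       (∸-monoʳ-< z<s (column< j))

    cell : ∀ e → QueueCell e ⊎ StackCell e
    cell (i , j) = strip-or-rotated q s (toℕ i) (toℕ j) (column< j)

    colour : Edge n → Fin s ⊎ Fin q
    colour e = class e (cell e)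

    stack-path : ∀ {e k} → colour e ≡ inj₁ k → Σ (StackCell e) λ R → path R ≡ toℕ k
    stack-path {e} eq with cell e
    stack-path refl | inj₂ R = R , sym (Fin.toℕ-fromℕ< _)

    queue-path : ∀ {e k} → colour e ≡ inj₂ k → Σ (QueueCell e) λ R → path R ≡ toℕ k
    queue-path {e} eq with cell e
    queue-path refl | inj₁ R = R , sym (Fin.toℕ-fromℕ< _)

    stack-uncrossed : ∀ {k} e f → colour e ≡ inj₁ k → colour f ≡ inj₁ k → ¬ CrossOrdered pos e f
    stack-uncrossed e f ce cf (l<l , _ , r<r) with stack-path {e} ce | stack-path {f} cf
    ... | R , eqR | R' , eqR' = <⇒≢
      -- After the quarter turn the crossing pair is strictly decreasing, with `f` as the upper
      -- cell.
      (path-mono-< R' R (∸-suc-anti-< (right<⇒column< e f r<r) (column< (proj₂ f)))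
                        (left<⇒row< e f l<l))
      (trans eqR' (sym eqR))

    queue-unnested : ∀ {k} e f → colour e ≡ inj₂ k → colour f ≡ inj₂ k → ¬ NestOrdered pos e f
    queue-unnested e f ce cf (l<l , _ , r<r) with queue-path {e} ce | queue-path {f} cf
    ... | R , eqR | R' , eqR' = <⇒≢
      (path-mono-< R R' (left<⇒row< e f l<l) (right<⇒column< f e r<r))
      (trans eqR (sym eqR'))

    layout : HasSeparatedMixedLayout n s q
    layout = pos , pos-injective , inj₁ U≺V , colour ,
      (λ { k e f ce cf (_ , inj₁ e×f) → stack-uncrossed e f ce cf e×f
         ; k e f ce cf (_ , inj₂ f×e) → stack-uncrossed f e cf ce f×e }) ,
      (λ { k e f ce cf (_ , inj₁ e⊃f) → queue-unnested e f ce cf e⊃f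
         ; k e f ce cf (_ , inj₂ f⊃e) → queue-unnested f e cf ce f⊃e })

  2n≤3⌈2n/3⌉ : ∀ n → 2 * n ≤ 3 * ⌈ 2 * n /3⌉
  2n≤3⌈2n/3⌉ n = +-cancelʳ-≤ 2 _ _ (begin
    2 * n + 2                                ≡⟨ m≡m%n+[m/n]*n (2 * n + 2) 3 ⟩
    (2 * n + 2) % 3 + ⌈ 2 * n /3⌉ * 3        ≤⟨ +-monoˡ-≤ _ (s≤s⁻¹ (m%n<n (2 * n + 2) 3)) ⟩
    2 + ⌈ 2 * n /3⌉ * 3                      ≡⟨ shuffle ⌈ 2 * n /3⌉ ⟩
    3 * ⌈ 2 * n /3⌉ + 2                      ∎)
    where
    open ≤-Reasoning
    shuffle : ∀ m → 2 + m * 3 ≡ 3 * m + 2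
    shuffle = solve-∀

  ⌈n/2⌉≤1+⌊n/2⌋ : ∀ n → ⌈ n /2⌉ ≤ suc ⌊ n /2⌋
  ⌈n/2⌉≤1+⌊n/2⌋ zero          = z≤n
  ⌈n/2⌉≤1+⌊n/2⌋ (suc zero)    = ≤-refl
  ⌈n/2⌉≤1+⌊n/2⌋ (suc (suc n)) = s≤s (⌈n/2⌉≤1+⌊n/2⌋ n)

  -- Since `s ≤ q ≤ s + 1`, the columns are the tighter dimension, and
  -- `2 n ≤ 3 (s + q) ≤ 2 (2 s + q) + 1`; the odd excess disappears on halving.
  balanced-layout : ∀ n m → 2 * n ≤ 3 * m → HasSeparatedMixedLayout n ⌊ m /2⌋ ⌈ m /2⌉
  balanced-layout n m 2n≤3m = Layout.layout n s q (≤-trans n≤columns columns≤rows) n≤columns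
    where
    open ≤-Reasoning
    s = ⌊ m /2⌋
    q = ⌈ m /2⌉

    n≤columns : n ≤ s + (s + q)
    n≤columns = s≤s⁻¹ (*-cancelˡ-< 2 n (suc (s + (s + q))) (begin-strict
      2 * n                      ≤⟨ 2n≤3m ⟩
      3 * m                      ≡⟨ cong (3 *_) (⌊n/2⌋+⌈n/2⌉≡n m) ⟨
      3 * (s + q)                ≡⟨ shuffle₁ s q ⟩
      3 * s + 2 * q + q          ≤⟨ +-monoʳ-≤ (3 * s + 2 * q) (⌈n/2⌉≤1+⌊n/2⌋ m) ⟩
      3 * s + 2 * q + suc s      <⟨ n<1+n _ ⟩
      suc (3 * s + 2 * q + suc s) ≡⟨ shuffle₂ s q ⟩
      2 * suc (s + (s + q))      ∎))
      where
      shuffle₁ : ∀ s q → 3 * (s + q) ≡ 3 * s + 2 * q + q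
      shuffle₁ = solve-∀
      shuffle₂ : ∀ s q → suc (3 * s + 2 * q + suc s) ≡ 2 * suc (s + (s + q))
      shuffle₂ = solve-∀

    columns≤rows : s + (s + q) ≤ s + q + q
    columns≤rows = begin
      s + (s + q)  ≤⟨ +-monoʳ-≤ s (+-monoˡ-≤ q (⌊n/2⌋≤⌈n/2⌉ m)) ⟩
      s + (q + q)  ≡⟨ +-assoc s q q ⟨
      s + q + q    ∎

-- Chain heights of a partially coloured grid.

module ChainHeights where

  open import Data.Nat
  open import Data.Nat.Properties
  open import Data.Fin.Subset using (Subset; ⁅_⁆; _∪_; ∣_∣; _∈_; _⊆_) renaming (⊥ to ∅)
  open import Data.Fin.Subset.Properties

  NoStrictChain : ∀ {k} → (ℕ → ℕ → Maybe (Fin k)) → Set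
  NoStrictChain col = ∀ {x x' y y' t} → x < x' → y < y' → col x y ≡ just t → col x' y' ≢ just t

  -- `queue` is indexed by reversed columns, which makes its forbidden pairs increasing too, so that
  -- one notion of height serves both kinds of classes.
  Covered : ∀ {s q} → ℕ → (ℕ → ℕ → Maybe (Fin s)) → (ℕ → ℕ → Maybe (Fin q)) → Set
  Covered n stack queue = ∀ {x y} → x < n → y < n →
    (∃ λ t → stack x y ≡ just t) ⊎ (∃ λ t → queue x (n ∸ suc y) ≡ just t)

  -- The last row is prescribed exactly because products of the two heights enter the boundary sum
  -- there; on the last column the sum is linear in each height with positive coefficients, so an
  -- upper bound is enough.
  record Height (n k : ℕ) (col : ℕ → ℕ → Maybe (Fin k)) : Set where
    field
      height      : ℕ → ℕ → ℕ
      monoˡ       : ∀ x y → height x y ≤ height (suc x) y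
      monoʳ       : ∀ x y → height x y ≤ height x (suc y)
      diagonal    : ∀ x y → height (suc x) (suc y) ≤ suc (height x y)
      jump        : ∀ {x y t} → col x y ≡ just t → suc (height x y) ≤ height (suc x) (suc y)
      zeroˡ       : ∀ y → height 0 y ≡ 0
      zeroʳ       : ∀ x → height x 0 ≡ 0
      last-row    : ∀ y → height n y ≡ y ⊓ k
      last-column : ∀ {x} → x ≤ n → height x n ≤ x ⊓ k

  module _ {k : ℕ} (col : ℕ → ℕ → Maybe (Fin k)) (chainless : NoStrictChain col) where

    extend : Maybe (Fin k) → ℕ → ℕ
    extend nothing  _ = 0
    extend (just _) l = suc l

    -- longest x y is the length of a longest strict chain of coloured cells in
    -- the rectangle [0 , x) × [0 , y).
    longest : ℕ → ℕ → ℕ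
    longest zero    y       = 0
    longest (suc x) zero    = 0
    longest (suc x) (suc y) =
      longest x (suc y) ⊔ longest (suc x) y ⊔ extend (col x y) (longest x y)

    longest-zeroʳ : ∀ x → longest x 0 ≡ 0
    longest-zeroʳ zero    = refl
    longest-zeroʳ (suc x) = refl

    longest-monoˡ : ∀ x y → longest x y ≤ longest (suc x) y
    longest-monoˡ x zero    = ≤-reflexive (longest-zeroʳ x)
    longest-monoˡ x (suc y) = ≤-trans (m≤m⊔n _ _) (m≤m⊔n _ _)

    longest-monoʳ : ∀ x y → longest x y ≤ longest x (suc y)
    longest-monoʳ zero    y = z≤n
    longest-monoʳ (suc x) y = ≤-trans (m≤n⊔m (longest x (suc y)) _) (m≤m⊔n _ _)

    -- A step in one coordinate is bounded by the preceding diagonal step followed by monotonicity,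
    -- which closes the induction.
    longest-diagonal : ∀ x y → longest (suc x) (suc y) ≤ suc (longest x y)
    longest-diagonal x y = ⊔-lub (⊔-lub (up x y) (across x y)) (extend≤ (col x y))
      where
      up : ∀ x y → longest x (suc y) ≤ suc (longest x y)
      up zero    y = z≤n
      up (suc x) y = ≤-trans (longest-diagonal x y) (s≤s (longest-monoˡ x y))
      across : ∀ x y → longest (suc x) y ≤ suc (longest x y)
      across x zero    = z≤n
      across x (suc y) = ≤-trans (longest-diagonal x y) (s≤s (longest-monoʳ x y))
      extend≤ : ∀ c → extend c (longest x y) ≤ suc (longest x y)
      extend≤ nothing  = z≤n
      extend≤ (just _) = ≤-refl

    longest-jump : ∀ {x y t} → col x y ≡ just t → suc (longest x y) ≤ longest (suc x) (suc y)
    longest-jump {x} {y} eq = subst (λ c → extend c (longest x y) ≤ longest (suc x) (suc y)) eq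
                                (m≤n⊔m (longest x (suc y) ⊔ longest (suc x) y) _)

    longest≤x : ∀ x y → longest x y ≤ x
    longest≤x zero    y       = z≤n
    longest≤x (suc x) zero    = z≤n
    longest≤x (suc x) (suc y) = ≤-trans (longest-diagonal x y) (s≤s (longest≤x x y))

    longest≤y : ∀ x y → longest x y ≤ y
    longest≤y zero    y       = z≤n
    longest≤y (suc x) zero    = z≤n
    longest≤y (suc x) (suc y) = ≤-trans (longest-diagonal x y) (s≤s (longest≤y x y))

    singleton : Maybe (Fin k) → Subset k
    singleton nothing  = ∅
    singleton (just t) = ⁅ t ⁆

    -- The colours used on `[0 , x) × [0 , y)`, built by the same recursion as `longest` so that the
    -- two can be compared step by step.
    colours : ℕ → ℕ → Subset k
    colours zero    y       = ∅
    colours (suc x) zero    = ∅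
    colours (suc x) (suc y) = colours x (suc y) ∪ colours (suc x) y ∪ singleton (col x y)

    ∈colours⇒cell : ∀ x y {t} → t ∈ colours x y →
                    ∃ λ x' → ∃ λ y' → x' < x × y' < y × col x' y' ≡ just t
    ∈colours⇒cell zero    y    t∈ = contradiction t∈ ∉⊥
    ∈colours⇒cell (suc x) zero t∈ = contradiction t∈ ∉⊥
    ∈colours⇒cell (suc x) (suc y) t∈ with x∈p∪q⁻ _ _ t∈
    ... | inj₁ t∈₁ with ∈colours⇒cell x (suc y) t∈₁
    ...   | x' , y' , x'<x , y'<y , eq = x' , y' , m≤n⇒m≤1+n x'<x , y'<y , eq
    ∈colours⇒cell (suc x) (suc y) t∈ | inj₂ t∈' with x∈p∪q⁻ _ _ t∈'
    ... | inj₁ t∈₂ with ∈colours⇒cell (suc x) y t∈₂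
    ...   | x' , y' , x'<x , y'<y , eq = x' , y' , x'<x , m≤n⇒m≤1+n y'<y , eq
    ∈colours⇒cell (suc x) (suc y) {t} t∈ | inj₂ t∈' | inj₂ t∈₃ =
      x , y , ≤-refl , ≤-refl , here-cell (col x y) t∈₃
      where
      here-cell : ∀ c → t ∈ singleton c → c ≡ just t
      here-cell nothing  t∈ = contradiction t∈ ∉⊥
      here-cell (just u) t∈ = cong just (sym (x∈⁅y⁆⇒x≡y u t∈))

    colours-monoʳ : ∀ x y → colours x y ⊆ colours x (suc y)
    colours-monoʳ zero    y t∈ = t∈
    colours-monoʳ (suc x) y t∈ = q⊆p∪q (colours x (suc y)) _ (p⊆p∪q _ t∈)

    -- A cell of colour t sees no t strictly below and to the left of it, so a
    -- step that lengthens the chain also adds a colour.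
    longest≤∣colours∣ : ∀ x y → longest x y ≤ ∣ colours x y ∣
    longest≤∣colours∣ zero    y       = z≤n
    longest≤∣colours∣ (suc x) zero    = z≤n
    longest≤∣colours∣ (suc x) (suc y) = ⊔-lub (⊔-lub
      (≤-trans (longest≤∣colours∣ x (suc y)) (∣p∣≤∣p∪q∣ (colours x (suc y)) _))
      (≤-trans (longest≤∣colours∣ (suc x) y)
               (p⊆q⇒∣p∣≤∣q∣ {p = colours (suc x) y} {colours (suc x) (suc y)}
                            (colours-monoʳ (suc x) y))))
      (new-colour (col x y) refl)
      where
      new-colour : ∀ c → col x y ≡ c → extend c (longest x y) ≤ ∣ colours (suc x) (suc y) ∣
      new-colour nothing  _  = z≤n
      new-colour (just t) eq = ≤-<-trans (longest≤∣colours∣ x y) (p⊂q⇒∣p∣<∣q∣ {p = colours x y}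
        ( (λ t∈ → p⊆p∪q _ (colours-monoʳ x y t∈))
        , t
        , q⊆p∪q (colours x (suc y)) _ (q⊆p∪q (colours (suc x) y) _
            (subst (λ c → t ∈ singleton c) (sym eq) (x∈⁅x⁆ t)))
        , λ t∈ → let x' , y' , x'<x , y'<y , eq' = ∈colours⇒cell x y t∈
                 in chainless x'<x y'<y eq' eq ))

    longest≤k : ∀ x y → longest x y ≤ k
    longest≤k x y = ≤-trans (longest≤∣colours∣ x y) (∣p∣≤n (colours x y))

    -- The padding raises the last row from longest n y to its maximum y ⊓ k,
    -- so that the boundary term of Green's formula does not depend on col.
    padded-height : ∀ {n} → k ≤ n → Height n k col
    padded-height {n} k≤n = record
      { height      = λ x y → longest x y ⊔ pad x y
      ; monoˡ       = λ x y → ⊔-mono-≤ (longest-monoˡ x y) (⊓-monoʳ-≤ y (∸-monoˡ-≤ d (n≤1+n x)))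
      ; monoʳ       = λ x y → ⊔-mono-≤ (longest-monoʳ x y) (⊓-monoˡ-≤ (x ∸ d) (n≤1+n y))
      ; diagonal    = λ x y → ⊔-mono-≤ (longest-diagonal x y) (⊓-monoʳ-≤ (suc y) (suc-∸≤ x d))
      ; jump        = λ {x} {y} eq → ⊔-lub
          (≤-trans (longest-jump eq) (m≤m⊔n _ _))
          (pad-jump x y (longest-jump eq))
      ; zeroˡ       = λ y → n≤0⇒n≡0 (≤-trans (m⊓n≤n y _) (m∸n≤m 0 d))
      ; zeroʳ       = λ x → cong (_⊔ 0) (longest-zeroʳ x)
      ; last-row    = λ y → trans
          (cong (λ r → longest n y ⊔ (y ⊓ r)) n∸d≡k)
          (m≤n⇒m⊔n≡n (⊓-glb (longest≤y n y) (longest≤k n y)))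
      ; last-column = λ {x} x≤n → ⊔-lub
          (⊓-glb (longest≤x x n) (longest≤k x n))
          (⊓-glb (≤-trans (m⊓n≤n n _) (m∸n≤m x d))
                 (≤-trans (m⊓n≤n n _) (≤-trans (∸-monoˡ-≤ d x≤n) (≤-reflexive n∸d≡k))))
      }
      where
      d = n ∸ k

      n∸d≡k : n ∸ d ≡ k
      n∸d≡k = m∸[m∸n]≡n k≤n

      -- This is the longest strict chain in `[0 , x) × [0 , y)` if exactly the cells in rows from
      -- `d` on count; hence it obeys the same step bounds as `longest`.
      pad : ℕ → ℕ → ℕ
      pad x y = y ⊓ (x ∸ d)

      suc-∸≤ : ∀ x d → suc x ∸ d ≤ suc (x ∸ d)
      suc-∸≤ x       zero    = ≤-refl
      suc-∸≤ zero    (suc d) = ≤-trans (m∸n≤m 0 d) z≤n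
      suc-∸≤ (suc x) (suc d) = suc-∸≤ x d

      pad-jump : ∀ x y {l} → suc (longest x y) ≤ l → suc (pad x y) ≤ l ⊔ pad (suc x) (suc y)
      pad-jump x y {l} 1≤l with d ≤? x
      -- From row `d` on the padding itself rises by one along every diagonal; before that it is 0,
      -- and the jump of the chain suffices.
      ... | yes d≤x = ≤-trans (⊓-monoʳ-≤ (suc y) (≤-reflexive (sym (+-∸-assoc 1 d≤x)))) (m≤n⊔m l _)
      ... | no d≰x rewrite m≤n⇒m∸n≡0 (<⇒≤ (≰⇒> d≰x)) | ⊓-zeroʳ y =
        ≤-trans (s≤s z≤n) (≤-trans 1≤l (m≤m⊔n l _))

-- A discrete Green formula and the bound on a single cell.

module Circulation where

  open ChainHeights using (Covered; Height)
  open import Data.Nat as ℕ using (ℕ; zero; suc; s≤s; _∸_; _⊓_)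
  import Data.Nat.Properties as ℕ
  open import Data.Integer as ℤ using (ℤ; +_; 0ℤ; 1ℤ; -1ℤ; _+_; _-_; _*_; _≤_; +≤+)
  open import Data.Integer.Properties
  open import Data.Integer.Tactic.RingSolver using (solve-∀)
  open import Data.Fin.Properties using (all?)
  open import Relation.Nullary.Decidable using (from-yes)

  2ℤ : ℤ
  2ℤ = + 2

  sum : ℕ → (ℕ → ℤ) → ℤ
  sum zero    f = 0ℤ
  sum (suc n) f = sum n f + f n

  sum-mono-≤ : ∀ n {f g} → (∀ {i} → i ℕ.< n → f i ≤ g i) → sum n f ≤ sum n g
  sum-mono-≤ zero    f≤g = ≤-refl
  sum-mono-≤ (suc n) f≤g = +-mono-≤ (sum-mono-≤ n (λ i<n → f≤g (ℕ.m≤n⇒m≤1+n i<n))) (f≤g ℕ.≤-refl)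

  sum-cong : ∀ n {f g} → (∀ {i} → i ℕ.< n → f i ≡ g i) → sum n f ≡ sum n g
  sum-cong zero    f≡g = refl
  sum-cong (suc n) f≡g = cong₂ _+_ (sum-cong n (λ i<n → f≡g (ℕ.m≤n⇒m≤1+n i<n))) (f≡g ℕ.≤-refl)

  sum-split : ∀ m n f → sum (m ℕ.+ n) f ≡ sum m f + sum n (λ i → f (m ℕ.+ i))
  sum-split m zero    f rewrite ℕ.+-identityʳ m = sym (+-identityʳ _)
  sum-split m (suc n) f rewrite ℕ.+-suc m n | sum-split m n f = +-assoc (sum m f) _ _

  sum-const : ∀ n c → sum n (λ _ → c) ≡ + n * c
  sum-const zero    c = refl
  sum-const (suc n) c rewrite sum-const n c = step (+ n) c
    where
    step : ∀ n c → n * c + c ≡ (1ℤ + n) * c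
    step = solve-∀

  -- The factor `2ℤ` keeps the sum of the indices free of division.
  sum-arithmetic : ∀ n a b → sum n (λ i → a + b * (2ℤ * + i)) ≡ + n * a + b * (+ n * (+ n - 1ℤ))
  sum-arithmetic zero    a b = sym (trans (+-identityˡ _) (*-zeroʳ b))
  sum-arithmetic (suc n) a b rewrite sum-arithmetic n a b = step (+ n) a b
    where
    step : ∀ n a b → n * a + b * (n * (n - 1ℤ)) + (a + b * (+ 2 * n)) ≡
                     (1ℤ + n) * a + b * ((1ℤ + n) * (1ℤ + n - 1ℤ))
    step = solve-∀

  sum-+ : ∀ n f g → sum n (λ i → f i + g i) ≡ sum n f + sum n g
  sum-+ zero    f g = refl
  sum-+ (suc n) f g rewrite sum-+ n f g = step (sum n f) (sum n g) (f n) (g n)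
    where
    step : ∀ a b c d → a + b + (c + d) ≡ a + c + (b + d)
    step = solve-∀

  module _ (P Q : ℕ → ℕ → ℤ) where

    -- `P x y` belongs to the edge from `(x , y)` to `(x , suc y)`, `Q x y` to the one from
    -- `(x , y)` to `(suc x , y)`. Neighbouring cells see their common edge with opposite signs, so
    -- only the boundary survives summation.
    circulation : ℕ → ℕ → ℤ
    circulation x y = P (suc x) y - P x y + (Q x (suc y) - Q x y)

    green-row : ∀ x n → sum n (circulation x) ≡ sum n (λ y → P (suc x) y - P x y) + (Q x n - Q x 0)
    green-row x zero    = sym (trans (+-identityˡ _) (i≡j⇒i-j≡0 {Q x 0} refl))
    green-row x (suc n) rewrite green-row x n =
      step (sum n (λ y → P (suc x) y - P x y)) _ (Q x 0) (Q x n) (Q x (suc n))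
      where
      step : ∀ a p q₀ q₁ q₂ → a + (q₁ - q₀) + (p + (q₂ - q₁)) ≡ a + p + (q₂ - q₀)
      step = solve-∀

    sum-telescope-row : ∀ x n → sum n (λ y → P x y - P 0 y) + sum n (λ y → P (suc x) y - P x y) ≡
                                sum n (λ y → P (suc x) y - P 0 y)
    sum-telescope-row x n = trans (sym (sum-+ n _ _))
      (sum-cong n (λ {y} _ → step (P x y) (P 0 y) (P (suc x) y)))
      where
      step : ∀ a b c → a - b + (c - a) ≡ c - b
      step = solve-∀

    green : ∀ m n → sum m (λ x → sum n (circulation x)) ≡
                    sum n (λ y → P m y - P 0 y) + sum m (λ x → Q x n - Q x 0)
    green zero    n = sym (trans (+-identityʳ _) (trans
      (sum-cong n (λ {y} _ → i≡j⇒i-j≡0 {P 0 y} refl)) (trans (sum-const n 0ℤ) (*-zeroʳ (+ n)))))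
    green (suc m) n rewrite green m n | green-row m n | sym (sum-telescope-row m n) =
      step (sum n (λ y → P m y - P 0 y)) _ _ _
      where
      step : ∀ a b c d → a + b + (c + d) ≡ a + c + (b + d)
      step = solve-∀

  -- With a = f₁₁ − f₀₀ and b = g₁₀ − g₀₁ the circulation around a unit cell is
  -- 2 a + 2 b − D, where D is twice the area of the image of the cell under
  -- (f , g); the terms f₀ g₁ − f₁ g₀ are those of the shoelace formula.
  vertical horizontal : ℤ → ℤ → ℤ → ℤ → ℤ
  vertical   f₀ f₁ g₀ g₁ = 2ℤ * f₁ + 2ℤ * g₀ + (f₀ * g₁ - f₁ * g₀)
  horizontal f₀ f₁ g₀ g₁ = 2ℤ * f₀ - 2ℤ * g₀ - (f₀ * g₁ - f₁ * g₀)

  cell-circulation : (f₀₀ f₀₁ f₁₀ f₁₁ g₀₀ g₀₁ g₁₀ g₁₁ : ℤ) → ℤ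
  cell-circulation f₀₀ f₀₁ f₁₀ f₁₁ g₀₀ g₀₁ g₁₀ g₁₁ =
    vertical f₁₀ f₁₁ g₁₀ g₁₁ - vertical f₀₀ f₀₁ g₀₀ g₀₁ +
    (horizontal f₀₁ f₁₁ g₀₁ g₁₁ - horizontal f₀₀ f₁₀ g₀₀ g₁₀)

  -- Increments are taken from the lowest corner, `f₀₀` for `f` and `g₀₁` for `g`. The bracket is
  -- the cross product of the diagonals `(a , δ - γ)` and `(β - α , b)` of the image quadrilateral,
  -- that is, twice its signed area.
  surplus : (α β a γ δ b : ℤ) → ℤ
  surplus α β a γ δ b = 2ℤ * a + 2ℤ * b - (a * b + (δ - γ) * (α - β))

  cell-circulation≡surplus : ∀ u α β a w γ δ b →
    cell-circulation u (α + u) (β + u) (a + u) (γ + w) w (b + w) (δ + w) ≡ surplus α β a γ δ b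
  cell-circulation≡surplus = identity
    where
    identity : ∀ u α β a w γ δ b →
      (+ 2 * (a + u) + + 2 * (b + w) + ((β + u) * (δ + w) - (a + u) * (b + w))) -
      (+ 2 * (α + u) + + 2 * (γ + w) + (u * w - (α + u) * (γ + w))) +
      ((+ 2 * (α + u) - + 2 * w - ((α + u) * (δ + w) - (a + u) * w)) -
       (+ 2 * u - + 2 * (γ + w) - (u * (b + w) - (β + u) * (γ + w)))) ≡
      + 2 * a + + 2 * b - (a * b + (δ - γ) * (α - β))
    identity = solve-∀

  -- Corner values of a height on a cell, from the lowest corner over the two side corners to the
  -- highest. Monotonicity forces all four to agree unless the diagonal rises, and then each side
  -- corner is a free bit.
  data Shape (l : ℕ) : ℕ → ℕ → ℕ → Set where
    flat   : Shape l l l l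
    rising : (α β : Fin 2) → Shape l (toℕ α ℕ.+ l) (toℕ β ℕ.+ l) (suc l)

  step-bit : ∀ {a b} → a ℕ.≤ b → b ℕ.≤ suc a → Σ (Fin 2) λ β → b ≡ toℕ β ℕ.+ a
  step-bit a≤b b≤1+a with ℕ.m≤n⇒m<n∨m≡n b≤1+a
  ... | inj₁ b<1+a = zero , ℕ.≤-antisym (ℕ.s≤s⁻¹ b<1+a) a≤b
  ... | inj₂ b≡1+a = suc zero , b≡1+a

  shape : ∀ {l m m' h} → l ℕ.≤ m → m ℕ.≤ h → l ℕ.≤ m' → m' ℕ.≤ h → h ℕ.≤ suc l → Shape l m m' h
  shape l≤m m≤h l≤m' m'≤h h≤1+l with step-bit (ℕ.≤-trans l≤m m≤h) h≤1+l
  ... | zero , refl with ℕ.≤-antisym l≤m m≤h | ℕ.≤-antisym l≤m' m'≤h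
  ...   | refl | refl = flat
  shape l≤m m≤h l≤m' m'≤h h≤1+l | suc zero , refl with step-bit l≤m m≤h | step-bit l≤m' m'≤h
  ... | α , refl | β , refl = rising α β

  -- If both heights rise, twice the area is at most 2, which leaves at least 4 - 2. If only one
  -- rises, the image lies on a segment and the value is exactly 2. A coloured cell excludes the
  -- flat case.
  cell-bound : ∀ {f₀₀ f₀₁ f₁₀ f₁₁ g₀₀ g₀₁ g₁₀ g₁₁} →
    Shape f₀₀ f₀₁ f₁₀ f₁₁ → Shape g₀₁ g₀₀ g₁₁ g₁₀ → f₀₀ ℕ.< f₁₁ ⊎ g₀₁ ℕ.< g₁₀ →
    2ℤ ≤ cell-circulation (+ f₀₀) (+ f₀₁) (+ f₁₀) (+ f₁₁) (+ g₀₀) (+ g₀₁) (+ g₁₀) (+ g₁₁)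
  cell-bound {u} {g₀₁ = w} (rising α β) (rising γ δ) _ =
    subst (2ℤ ≤_)
      (sym (cell-circulation≡surplus (+ u) (+ toℕ α) (+ toℕ β) 1ℤ (+ w) (+ toℕ γ) (+ toℕ δ) 1ℤ))
      (both-rise α β γ δ)
    where
    both-rise : ∀ (α β γ δ : Fin 2) →
      2ℤ ≤ surplus (+ toℕ α) (+ toℕ β) 1ℤ (+ toℕ γ) (+ toℕ δ) 1ℤ
    both-rise = from-yes (all? λ (α : Fin 2) → all? λ (β : Fin 2) →
                          all? λ (γ : Fin 2) → all? λ (δ : Fin 2) →
      2ℤ ≤? surplus (+ toℕ α) (+ toℕ β) 1ℤ (+ toℕ γ) (+ toℕ δ) 1ℤ)
  cell-bound {u} {g₀₁ = w} (rising α β) flat _ = ≤-reflexive (sym (trans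
    (cell-circulation≡surplus (+ u) (+ toℕ α) (+ toℕ β) 1ℤ (+ w) 0ℤ 0ℤ 0ℤ)
    (only-f-rises (+ toℕ α) (+ toℕ β))))
    where
    only-f-rises : ∀ α β → + 2 * 1ℤ + + 2 * 0ℤ - (1ℤ * 0ℤ + (0ℤ - 0ℤ) * (α - β)) ≡ + 2
    only-f-rises = solve-∀
  cell-bound {u} {g₀₁ = w} flat (rising γ δ) _ = ≤-reflexive (sym (trans
    (cell-circulation≡surplus (+ u) 0ℤ 0ℤ 0ℤ (+ w) (+ toℕ γ) (+ toℕ δ) 1ℤ)
    (only-g-rises (+ toℕ γ) (+ toℕ δ))))
    where
    only-g-rises : ∀ γ δ → + 2 * 0ℤ + + 2 * 1ℤ - (0ℤ * 1ℤ + (δ - γ) * (0ℤ - 0ℤ)) ≡ + 2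
    only-g-rises = solve-∀
  cell-bound flat flat (inj₁ f<f) = contradiction f<f (ℕ.<-irrefl refl)
  cell-bound flat flat (inj₂ g<g) = contradiction g<g (ℕ.<-irrefl refl)

  sum-⊓ : ∀ k d → sum (k ℕ.+ d) (λ x → 2ℤ * + (x ⊓ k)) ≡ + k * (+ k - 1ℤ) + 2ℤ * (+ k * + d)
  sum-⊓ k d = begin
    sum (k ℕ.+ d) f                               ≡⟨ sum-split k d f ⟩
    sum k f + sum d (λ i → f (k ℕ.+ i))           ≡⟨ cong₂ _+_ below above ⟩
    + k * (+ k - 1ℤ) + + d * (2ℤ * + k)           ≡⟨ regroup (+ k) (+ d) ⟩
    + k * (+ k - 1ℤ) + 2ℤ * (+ k * + d)           ∎
    where
    open ≡-Reasoning
    f : ℕ → ℤ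
    f x = 2ℤ * + (x ⊓ k)

    as-arithmetic : ∀ i → + 2 * i ≡ 0ℤ + 1ℤ * (+ 2 * i)
    as-arithmetic = solve-∀
    arithmetic-value : ∀ k → k * 0ℤ + 1ℤ * (k * (k - 1ℤ)) ≡ k * (k - 1ℤ)
    arithmetic-value = solve-∀
    regroup : ∀ k d → k * (k - 1ℤ) + d * (+ 2 * k) ≡ k * (k - 1ℤ) + + 2 * (k * d)
    regroup = solve-∀

    below : sum k f ≡ + k * (+ k - 1ℤ)
    below = begin
      sum k f                                ≡⟨ sum-cong k (λ {i} i<k →
                                                  trans (cong (λ z → 2ℤ * + z) (ℕ.m≤n⇒m⊓n≡m (ℕ.<⇒≤ i<k)))
                                                        (as-arithmetic (+ i))) ⟩
      sum k (λ i → 0ℤ + 1ℤ * (2ℤ * + i))     ≡⟨ sum-arithmetic k 0ℤ 1ℤ ⟩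
      + k * 0ℤ + 1ℤ * (+ k * (+ k - 1ℤ))     ≡⟨ arithmetic-value (+ k) ⟩
      + k * (+ k - 1ℤ)                       ∎

    above : sum d (λ i → f (k ℕ.+ i)) ≡ + d * (2ℤ * + k)
    above = trans (sum-cong d (λ {i} _ → cong (λ z → 2ℤ * + z) (ℕ.m≥n⇒m⊓n≡n (ℕ.m≤m+n k i))))
                  (sum-const d (2ℤ * + k))

  -- Boundary sums over the grid of side `s + r + q`.

  module _ {s q r : ℕ} {stack : ℕ → ℕ → Maybe (Fin s)} {queue : ℕ → ℕ → Maybe (Fin q)}
    (covered : Covered (s ℕ.+ (r ℕ.+ q)) stack queue)
    (F : Height (s ℕ.+ (r ℕ.+ q)) s stack) (G : Height (s ℕ.+ (r ℕ.+ q)) q queue) where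

    private
      module F = Height F
      module G = Height G

    n : ℕ
    n = s ℕ.+ (r ℕ.+ q)

    -- Queues avoid strict chains only after reversing the columns, whence n ∸ y.
    f g : ℕ → ℕ → ℤ
    f x y = + F.height x y
    g x y = + G.height x (n ∸ y)

    P Q : ℕ → ℕ → ℤ
    P x y = vertical   (f x y) (f x (suc y)) (g x y) (g x (suc y))
    Q x y = horizontal (f x y) (f (suc x) y) (g x y) (g (suc x) y)

    suc-∸-suc : ∀ {m y} → y ℕ.< m → m ∸ y ≡ suc (m ∸ suc y)
    suc-∸-suc (s≤s {n = m} y≤m) = ℕ.+-∸-assoc 1 y≤m

    circulation≥2 : ∀ {x y} → x ℕ.< n → y ℕ.< n → 2ℤ ≤ circulation P Q x y
    circulation≥2 {x} {y} x<n y<n rewrite suc-∸-suc y<n = cell-bound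
      (shape (F.monoʳ x y) (F.monoˡ x (suc y)) (F.monoˡ x y) (F.monoʳ (suc x) y) (F.diagonal x y))
      -- As columns are reversed, the lowest corner of `G` at column `z` is `g₀₁`.
      (shape (G.monoʳ x z) (G.monoˡ x (suc z)) (G.monoˡ x z) (G.monoʳ (suc x) z) (G.diagonal x z))
      (jumps (covered x<n y<n))
      where
      z = n ∸ suc y
      jumps : (∃ λ t → stack x y ≡ just t) ⊎ (∃ λ t → queue x z ≡ just t) →
              F.height x y ℕ.< F.height (suc x) (suc y) ⊎ G.height x z ℕ.< G.height (suc x) (suc z)
      jumps (inj₁ (_ , eq)) = inj₁ (F.jump eq)
      jumps (inj₂ (_ , eq)) = inj₂ (G.jump eq)

    P-first : ∀ y → P 0 y ≡ 0ℤ
    P-first y rewrite F.zeroˡ y | F.zeroˡ (suc y) | G.zeroˡ (n ∸ y) = refl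

    -- `g` vanishes on the last column and `f` on the first, so the shoelace terms drop out and what
    -- remains is linear.
    Q-difference : ∀ {x} → x ℕ.≤ n → Q x n - Q x 0 ≤ 2ℤ * + (x ⊓ s) + 2ℤ * + (x ⊓ q)
    Q-difference {x} x≤n
      rewrite ℕ.n∸n≡0 n | G.zeroʳ x | G.zeroʳ (suc x) | F.zeroʳ x | F.zeroʳ (suc x) =
      subst (_≤ 2ℤ * + (x ⊓ s) + 2ℤ * + (x ⊓ q))
        (sym (simplify (f x n) (f (suc x) n) (+ G.height x n) (+ G.height (suc x) n)))
        (+-mono-≤ (*-monoˡ-≤-nonNeg 2ℤ (+≤+ (F.last-column x≤n)))
                  (*-monoˡ-≤-nonNeg 2ℤ (+≤+ (G.last-column x≤n))))
      where
      simplify : ∀ f₀ f₁ g₀ g₁ →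
        (+ 2 * f₀ - + 2 * 0ℤ - (f₀ * 0ℤ - f₁ * 0ℤ)) - (+ 2 * 0ℤ - + 2 * g₀ - (0ℤ * g₁ - 0ℤ * g₀)) ≡
        + 2 * f₀ + + 2 * g₀
      simplify = solve-∀

    P-last : ∀ y {a a' b b'} → y ⊓ s ≡ a → suc y ⊓ s ≡ a' → (n ∸ y) ⊓ q ≡ b → (n ∸ suc y) ⊓ q ≡ b' →
             P n y ≡ vertical (+ a) (+ a') (+ b) (+ b')
    P-last y refl refl refl refl
      rewrite F.last-row y | F.last-row (suc y) | G.last-row (n ∸ y) | G.last-row (n ∸ suc y) = refl

    -- On the last row `f` is `y ⊓ s` and `g` is `(n ∸ y) ⊓ q`: first `f` climbs for `s` steps, then
    -- both rest for `r` steps, then `g` descends for `q` steps. Each range has its own formula.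
    P-initial : ∀ {y} → y ℕ.< s → P n y ≡ (+ q + 2ℤ) + 1ℤ * (2ℤ * + y)
    P-initial {y} y<s = trans
      (P-last y (ℕ.m≤n⇒m⊓n≡m (ℕ.<⇒≤ y<s)) (ℕ.m≤n⇒m⊓n≡m y<s) (large (ℕ.<⇒≤ y<s)) (large y<s))
      (value (+ y) (+ q))
      where
      large : ∀ {y} → y ℕ.≤ s → (n ∸ y) ⊓ q ≡ q
      large {y} y≤s = ℕ.m≥n⇒m⊓n≡n (begin
        q              ≤⟨ ℕ.m≤n+m q r ⟩
        r ℕ.+ q        ≡⟨ ℕ.m+n∸m≡n s (r ℕ.+ q) ⟨
        n ∸ s          ≤⟨ ℕ.∸-monoʳ-≤ n y≤s ⟩
        n ∸ y          ∎)
        where open ℕ.≤-Reasoning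
      value : ∀ y q → + 2 * (1ℤ + y) + + 2 * q + (y * q - (1ℤ + y) * q) ≡ q + + 2 + 1ℤ * (+ 2 * y)
      value = solve-∀

    P-middle : ∀ {i} → i ℕ.< r → P n (s ℕ.+ i) ≡ 2ℤ * (+ s + + q)
    P-middle {i} i<r = trans
      (P-last (s ℕ.+ i) (ℕ.m≥n⇒m⊓n≡n (ℕ.m≤m+n s i)) (ℕ.m≥n⇒m⊓n≡n (ℕ.m≤n⇒m≤1+n (ℕ.m≤m+n s i)))
        (large (ℕ.<⇒≤ i<r))
        (trans (cong (λ y → (n ∸ y) ⊓ q) (sym (ℕ.+-suc s i))) (large i<r)))
      (value (+ s) (+ q))
      where
      large : ∀ {i} → i ℕ.≤ r → (n ∸ (s ℕ.+ i)) ⊓ q ≡ q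
      large {i} i≤r = ℕ.m≥n⇒m⊓n≡n (begin
        q                  ≡⟨ ℕ.m+n∸m≡n r q ⟨
        r ℕ.+ q ∸ r        ≤⟨ ℕ.∸-monoʳ-≤ (r ℕ.+ q) i≤r ⟩
        r ℕ.+ q ∸ i        ≡⟨ ℕ.[m+n]∸[m+o]≡n∸o s (r ℕ.+ q) i ⟨
        n ∸ (s ℕ.+ i)      ∎)
        where open ℕ.≤-Reasoning
      value : ∀ s q → + 2 * s + + 2 * q + (s * q - s * q) ≡ + 2 * (s + q)
      value = solve-∀

    P-final : ∀ {i} → i ℕ.< q → P n (s ℕ.+ (r ℕ.+ i)) ≡ (+ s + 2ℤ * + q) + -1ℤ * (2ℤ * + i)
    P-final {i} i<q = trans
      (P-last (s ℕ.+ (r ℕ.+ i))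
        (ℕ.m≥n⇒m⊓n≡n (ℕ.m≤m+n s _)) (ℕ.m≥n⇒m⊓n≡n (ℕ.m≤n⇒m≤1+n (ℕ.m≤m+n s _)))
        -- Writing `q ∸ i` as `suc z` makes both values of `g`, and `q` itself as `suc i + z`,
        -- polynomials in `i` and `z`.
        (trans (small (ℕ.<⇒≤ i<q)) (suc-∸-suc i<q))
        (trans (cong (λ y → (n ∸ y) ⊓ q) (sym (trans (cong (s ℕ.+_) (ℕ.+-suc r i)) (ℕ.+-suc s _))))
               (small i<q)))
      (trans (value (+ s) (+ i) (+ z))
             (cong (λ w → (+ s + 2ℤ * w) + -1ℤ * (2ℤ * + i)) (cong +_ (ℕ.m+[n∸m]≡n i<q))))
      where
      z = q ∸ suc i
      small : ∀ {i} → i ℕ.≤ q → (n ∸ (s ℕ.+ (r ℕ.+ i))) ⊓ q ≡ q ∸ i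
      small {i} i≤q = trans
        (cong (_⊓ q) (trans (ℕ.[m+n]∸[m+o]≡n∸o s (r ℕ.+ q) (r ℕ.+ i)) (ℕ.[m+n]∸[m+o]≡n∸o r q i)))
        (ℕ.m≤n⇒m⊓n≡m (ℕ.m∸n≤m q i))
      value : ∀ s i z → + 2 * s + + 2 * (1ℤ + z) + (s * z - s * (1ℤ + z)) ≡
                        s + + 2 * (1ℤ + i + z) + -1ℤ * (+ 2 * i)
      value = solve-∀

    sum-P : sum n (λ y → P n y - P 0 y) ≡
      + s * (+ q + 2ℤ) + 1ℤ * (+ s * (+ s - 1ℤ)) +
      (+ r * (2ℤ * (+ s + + q)) + (+ q * (+ s + 2ℤ * + q) + -1ℤ * (+ q * (+ q - 1ℤ))))
    sum-P = trans
      (sum-cong n (λ {y} _ → trans (cong (λ p → P n y - p) (P-first y)) (+-identityʳ (P n y))))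
      (trans (sum-split s (r ℕ.+ q) (P n)) (cong₂ _+_
        (trans (sum-cong s P-initial) (sum-arithmetic s _ 1ℤ))
        (trans (sum-split r q (λ i → P n (s ℕ.+ i))) (cong₂ _+_
          (trans (sum-cong r P-middle) (sum-const r _))
          (trans (sum-cong q P-final) (sum-arithmetic q _ -1ℤ))))))

    sum-Q : sum n (λ x → Q x n - Q x 0) ≤
      + s * (+ s - 1ℤ) + 2ℤ * (+ s * (+ r + + q)) + (+ q * (+ q - 1ℤ) + 2ℤ * (+ q * (+ s + + r)))
    sum-Q = ≤-trans (sum-mono-≤ n (λ x<n → Q-difference (ℕ.<⇒≤ x<n)))
      (≤-reflexive (trans (sum-+ n _ _) (cong₂ _+_
        (sum-⊓ s (r ℕ.+ q))
        (trans (cong (λ m → sum m (λ x → 2ℤ * + (x ⊓ q))) n≡q+[s+r]) (sum-⊓ q (s ℕ.+ r))))))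
      where
      n≡q+[s+r] : n ≡ q ℕ.+ (s ℕ.+ r)
      n≡q+[s+r] = trans (sym (ℕ.+-assoc s r q)) (ℕ.+-comm (s ℕ.+ r) q)

    -- The cells contribute at least `2 n²` together, while the boundary is at most
    -- `2 n² + 2 (s q - r²)`.
    r²≤sq : r ℕ.* r ℕ.≤ s ℕ.* q
    r²≤sq = drop‿+≤+ (subst₂ _≤_ (sym (pos-* r r)) (sym (pos-* s q))
      (0≤i-j⇒j≤i (*-cancelˡ-≤-pos 0ℤ (+ s * + q - + r * + r) 2ℤ
        (subst (0ℤ ≤_) (difference (+ s) (+ r) (+ q)) (i≤j⇒0≤j-i total)))))
      where
      total : + n * (+ n * 2ℤ) ≤
        (+ s * (+ q + 2ℤ) + 1ℤ * (+ s * (+ s - 1ℤ)) +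
        (+ r * (2ℤ * (+ s + + q)) + (+ q * (+ s + 2ℤ * + q) + -1ℤ * (+ q * (+ q - 1ℤ))))) +
        (+ s * (+ s - 1ℤ) + 2ℤ * (+ s * (+ r + + q)) + (+ q * (+ q - 1ℤ) + 2ℤ * (+ q * (+ s + + r))))
      total = begin
        + n * (+ n * 2ℤ)                                 ≡⟨ sum-const n _ ⟨
        sum n (λ x → + n * 2ℤ)                           ≡⟨ sum-cong n (λ _ → sum-const n 2ℤ) ⟨
        sum n (λ x → sum n (λ y → 2ℤ))
          ≤⟨ sum-mono-≤ n (λ x<n → sum-mono-≤ n (circulation≥2 x<n)) ⟩
        sum n (λ x → sum n (circulation P Q x))          ≡⟨ green P Q n n ⟩
        sum n (λ y → P n y - P 0 y) + sum n (λ x → Q x n - Q x 0)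
          ≤⟨ +-mono-≤ (≤-reflexive sum-P) sum-Q ⟩
        _                                                ∎
        where open ≤-Reasoning
      difference : ∀ s r q →
        ((s * (q + + 2) + 1ℤ * (s * (s - 1ℤ)) +
        (r * (+ 2 * (s + q)) + (q * (s + + 2 * q) + -1ℤ * (q * (q - 1ℤ))))) +
        (s * (s - 1ℤ) + + 2 * (s * (r + q)) + (q * (q - 1ℤ) + + 2 * (q * (s + r))))) -
        (s + (r + q)) * ((s + (r + q)) * + 2) ≡ + 2 * (s * q - r * r)
      difference = solve-∀

-- Lower bound: from a layout to a coloured grid.

module LowerBound where

  open ChainHeights using (NoStrictChain; Covered; padded-height)
  open Circulation using (r²≤sq)
  open import Data.Nat
  open import Data.Nat.Properties
  open import Data.Nat.DivMod using (m<n*o⇒m/o<n)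
  open import Data.Nat.Tactic.RingSolver using (solve-∀)
  import Data.Fin.Properties as Fin

  argmin : ∀ {n} (p : Fin (suc n) → ℕ) → Σ (Fin (suc n)) λ i → ∀ j → p i ≤ p j
  argmin {zero} p = zero , λ { zero → ≤-refl }
  argmin {suc n} p with argmin (p ∘ suc)
  ... | i , min with p zero ≤? p (suc i)
  ...   | yes p0≤pi = zero , λ { zero → ≤-refl ; (suc j) → ≤-trans p0≤pi (min j) }
  ...   | no  p0≰pi = suc i , λ { zero → <⇒≤ (≰⇒> p0≰pi) ; (suc j) → min j }

  -- Selection sort: the minimum comes first, and `punchIn` embeds the sorted remainder around it.
  sorting : ∀ {n} (p : Fin n → ℕ) → Injective _≡_ _≡_ p →
            Σ (Fin n → Fin n) λ σ → ∀ {x y} → x Fin.< y → p (σ x) < p (σ y)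
  sorting {zero} p inj = (λ ()) , λ { {()} }
  sorting {suc n} p inj with argmin p
  ... | i , min with sorting (p ∘ punchIn i) (Fin.punchIn-injective i _ _ ∘ inj)
  ...   | σ , mono = τ , τ-mono
    where
    τ : Fin (suc n) → Fin (suc n)
    τ zero    = i
    τ (suc x) = punchIn i (σ x)
    τ-mono : ∀ {x y} → x Fin.< y → p (τ x) < p (τ y)
    τ-mono {zero}  {suc y} _         = ≤∧≢⇒< (min _) (Fin.punchInᵢ≢i i (σ y) ∘ sym ∘ inj)
    τ-mono {suc x} {suc y} (s≤s x<y) = mono x<y

  module _ {n : ℕ} {pos : Order n} (sep : Separated pos) where

    cross-of : ∀ {i i' j j'} → pos (inj₁ i) < pos (inj₁ i') → pos (inj₂ j) < pos (inj₂ j') →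
               Cross pos (i , j) (i' , j')
    cross-of {i} {i'} {j} {j'} i<i' j<j' =
      ((λ { refl → <-irrefl refl i<i' }) , (λ { refl → <-irrefl refl j<j' })) , inj₁ (ordered sep)
      where
      ordered : Separated pos → CrossOrdered pos (i , j) (i' , j')
      ordered (inj₁ U≺V)
        rewrite m≤n⇒m⊓n≡m (<⇒≤ (U≺V i j)) | m≤n⇒m⊓n≡m (<⇒≤ (U≺V i' j'))
              | m≤n⇒m⊔n≡n (<⇒≤ (U≺V i j)) | m≤n⇒m⊔n≡n (<⇒≤ (U≺V i' j'))
        = i<i' , U≺V i' j , j<j'
      ordered (inj₂ V≺U)
        rewrite m≥n⇒m⊓n≡n (<⇒≤ (V≺U i j)) | m≥n⇒m⊓n≡n (<⇒≤ (V≺U i' j'))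
              | m≥n⇒m⊔n≡m (<⇒≤ (V≺U i j)) | m≥n⇒m⊔n≡m (<⇒≤ (V≺U i' j'))
        = j<j' , V≺U i j' , i<i'

    -- If `V` comes first, the left ends lie in `V` and the pair nests the other way round, whence
    -- the disjunction in `ordered`.
    nest-of : ∀ {i i' j j'} → pos (inj₁ i) < pos (inj₁ i') → pos (inj₂ j') < pos (inj₂ j) →
              Nest pos (i , j) (i' , j')
    nest-of {i} {i'} {j} {j'} i<i' j'<j =
      ((λ { refl → <-irrefl refl i<i' }) , (λ { refl → <-irrefl refl j'<j })) , ordered sep
      where
      ordered : Separated pos → NestOrdered pos (i , j) (i' , j') ⊎ NestOrdered pos (i' , j') (i , j)
      ordered (inj₁ U≺V)
        rewrite m≤n⇒m⊓n≡m (<⇒≤ (U≺V i j)) | m≤n⇒m⊓n≡m (<⇒≤ (U≺V i' j'))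
              | m≤n⇒m⊔n≡n (<⇒≤ (U≺V i j)) | m≤n⇒m⊔n≡n (<⇒≤ (U≺V i' j'))
        = inj₁ (i<i' , U≺V i' j' , j'<j)
      ordered (inj₂ V≺U)
        rewrite m≥n⇒m⊓n≡n (<⇒≤ (V≺U i j)) | m≥n⇒m⊓n≡n (<⇒≤ (V≺U i' j'))
              | m≥n⇒m⊔n≡m (<⇒≤ (V≺U i j)) | m≥n⇒m⊔n≡m (<⇒≤ (V≺U i' j'))
        = inj₂ (j'<j , V≺U i j , i<i')

  module _ {n : ℕ} {A : Set} (M : Fin n → Fin n → Maybe A) where

    -- Heights live on all of `ℕ × ℕ`; cells outside the grid get no colour and so enter no chain.
    extension : ℕ → ℕ → Maybe A
    extension x y with x <? n | y <? n
    ... | yes x<n | yes y<n = M (fromℕ< x<n) (fromℕ< y<n)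
    ... | _       | _       = nothing

    extension-just : ∀ {x y a} → extension x y ≡ just a →
                     ∃ λ i → ∃ λ j → toℕ i ≡ x × toℕ j ≡ y × M i j ≡ just a
    extension-just {x} {y} eq with x <? n | y <? n
    ... | yes x<n | yes y<n =
      fromℕ< x<n , fromℕ< y<n , Fin.toℕ-fromℕ< x<n , Fin.toℕ-fromℕ< y<n , eq

    extension-toℕ : ∀ i j → extension (toℕ i) (toℕ j) ≡ M i j
    extension-toℕ i j with toℕ i <? n | toℕ j <? n
    ... | yes i<n | yes j<n = cong₂ M (Fin.fromℕ<-toℕ i i<n) (Fin.fromℕ<-toℕ j j<n)
    ... | yes _   | no j≮n  = contradiction (Fin.toℕ<n j) j≮n
    ... | no i≮n  | _       = contradiction (Fin.toℕ<n i) i≮n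

  module Grid {n s q : ℕ} (K : Fin n → Fin n → Fin s ⊎ Fin q)
    (uncrossed : ∀ {x x' y y' t} → x Fin.< x' → y Fin.< y' → K x y ≡ inj₁ t → K x' y' ≢ inj₁ t)
    (unnested  : ∀ {x x' y y' t} → x Fin.< x' → y' Fin.< y → K x y ≡ inj₂ t → K x' y' ≢ inj₂ t)
    where

    stackCell : Fin n → Fin n → Maybe (Fin s)
    stackCell i j = isInj₁ (K i j)

    queueCell : Fin n → Fin n → Maybe (Fin q)
    queueCell i j = isInj₂ (K i (opposite j))

    stack : ℕ → ℕ → Maybe (Fin s)
    stack = extension stackCell

    queue : ℕ → ℕ → Maybe (Fin q)
    queue = extension queueCell

    isInj₁-just : ∀ (c : Fin s ⊎ Fin q) {t} → isInj₁ c ≡ just t → c ≡ inj₁ t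
    isInj₁-just (inj₁ _) refl = refl

    isInj₂-just : ∀ (c : Fin s ⊎ Fin q) {t} → isInj₂ c ≡ just t → c ≡ inj₂ t
    isInj₂-just (inj₂ _) refl = refl

    stack-chainless : NoStrictChain stack
    stack-chainless {x} {x'} {y} {y'} x<x' y<y' eq eq'
      with extension-just stackCell {x} {y} eq | extension-just stackCell {x'} {y'} eq'
    ... | i , j , refl , refl , Kt | i' , j' , refl , refl , K't =
      uncrossed x<x' y<y' (isInj₁-just _ Kt) (isInj₁-just _ K't)

    queue-chainless : NoStrictChain queue
    queue-chainless {x} {x'} {y} {y'} x<x' y<y' eq eq'
      with extension-just queueCell {x} {y} eq | extension-just queueCell {x'} {y'} eq'
    ... | i , j , refl , refl , Kt | i' , j' , refl , refl , K't =
      unnested x<x' opposite< (isInj₂-just _ Kt) (isInj₂-just _ K't)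
      where
      opposite< : opposite j' Fin.< opposite j
      opposite< = subst₂ _<_ (sym (Fin.opposite-prop j')) (sym (Fin.opposite-prop j))
                    (∸-monoʳ-< (s≤s y<y') (Fin.toℕ<n j'))

    covered-Fin : ∀ (i j : Fin n) → (∃ λ t → stack (toℕ i) (toℕ j) ≡ just t) ⊎
                                    (∃ λ t → queue (toℕ i) (n ∸ suc (toℕ j)) ≡ just t)
    covered-Fin i j with K i j in eq
    ... | inj₁ t = inj₁ (t , trans (extension-toℕ stackCell i j) (cong isInj₁ eq))
    ... | inj₂ t = inj₂ (t , (begin
      queue (toℕ i) (n ∸ suc (toℕ j))           ≡⟨ cong (queue (toℕ i)) (Fin.opposite-prop j) ⟨
      queue (toℕ i) (toℕ (opposite j))          ≡⟨ extension-toℕ queueCell i (opposite j) ⟩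
      isInj₂ (K i (opposite (opposite j)))      ≡⟨ cong (isInj₂ ∘ K i) (Fin.opposite-involutive j) ⟩
      isInj₂ (K i j)                            ≡⟨ cong isInj₂ eq ⟩
      just t                                    ∎))
      where open ≡-Reasoning

    covered : Covered n stack queue
    covered x<n y<n with covered-Fin (fromℕ< x<n) (fromℕ< y<n)
    ... | c rewrite Fin.toℕ-fromℕ< x<n | Fin.toℕ-fromℕ< y<n = c

  grid-bound : ∀ {s q r} → HasSeparatedMixedLayout (s + (r + q)) s q → r * r ≤ s * q
  grid-bound {s} {q} {r} (pos , inj , sep , c , uncrossed , unnested)
    with sorting (pos ∘ inj₁) (inj₁-injective ∘ inj) | sorting (pos ∘ inj₂) (inj₂-injective ∘ inj)
  ... | σ , σ-mono | τ , τ-mono =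
    r²≤sq covered (padded-height stack stack-chainless (m≤m+n s (r + q)))
                  (padded-height queue queue-chainless (≤-trans (m≤n+m q r) (m≤n+m (r + q) s)))
    where
    open Grid (λ x y → c (σ x , τ y))
      (λ x<x' y<y' ce cf → uncrossed _ _ _ ce cf (cross-of {pos = pos} sep (σ-mono x<x') (τ-mono y<y')))
      (λ x<x' y'<y ce cf → unnested _ _ _ ce cf (nest-of {pos = pos} sep (σ-mono x<x') (τ-mono y'<y)))

  m≤n⇒4mn≤[m+n]² : ∀ {m n} → m ≤ n → 4 * (m * n) ≤ (m + n) * (m + n)
  m≤n⇒4mn≤[m+n]² {m} m≤n with m≤n⇒∃[o]m+o≡n m≤n
  ... | d , refl = m+n≤o⇒m≤o _ (≤-reflexive (square m d))
    where
    square : ∀ m d → 4 * (m * (m + d)) + d * d ≡ (m + (m + d)) * (m + (m + d))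
    square = solve-∀

  4mn≤[m+n]² : ∀ m n → 4 * (m * n) ≤ (m + n) * (m + n)
  4mn≤[m+n]² m n with ≤-total m n
  ... | inj₁ m≤n = m≤n⇒4mn≤[m+n]² m≤n
  ... | inj₂ n≤m = subst₂ _≤_ (cong (4 *_) (*-comm n m)) (cong₂ _*_ (+-comm n m) (+-comm n m))
                              (m≤n⇒4mn≤[m+n]² n≤m)

  -- Otherwise `n` exceeds `s + q` by some `r` with `s + q < 2 r`, and
  -- `4 s q ≤ (s + q)² < 4 r² ≤ 4 s q` is absurd.
  2n≤3[s+q] : ∀ {n s q} → HasSeparatedMixedLayout n s q → 2 * n ≤ 3 * (s + q)
  2n≤3[s+q] {n} {s} {q} L with 2 * n ≤? 3 * (s + q)
  ... | yes 2n≤3m = 2n≤3m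
  ... | no 2n≰3m with m≤n⇒∃[o]m+o≡n s+q≤n
    where
    s+q≤n : s + q ≤ n
    s+q≤n = *-cancelˡ-≤ 2 (≤-trans (*-monoˡ-≤ (s + q) (n≤1+n 2)) (<⇒≤ (≰⇒> 2n≰3m)))
  ...   | r , refl = contradiction (begin-strict
      4 * (s * q)        ≤⟨ 4mn≤[m+n]² s q ⟩
      (s + q) * (s + q)  <⟨ *-mono-< s+q<2r s+q<2r ⟩
      (2 * r) * (2 * r)  ≡⟨ regroup r ⟩
      4 * (r * r)        ≤⟨ *-monoʳ-≤ 4 r*r≤s*q ⟩
      4 * (s * q)        ∎) (<-irrefl refl)
      where
      open ≤-Reasoning
      regroup : ∀ r → (2 * r) * (2 * r) ≡ 4 * (r * r)
      regroup = solve-∀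
      rearrange : ∀ s q r → s + q + r ≡ s + (r + q)
      rearrange = solve-∀
      triple : ∀ m → 3 * m ≡ 2 * m + m
      triple = solve-∀
      r*r≤s*q : r * r ≤ s * q
      r*r≤s*q = grid-bound (subst (λ n → HasSeparatedMixedLayout n s q) (rearrange s q r) L)
      s+q<2r : s + q < 2 * r
      s+q<2r = +-cancelˡ-< (2 * (s + q)) _ _
        (subst₂ _<_ (triple (s + q)) (*-distribˡ-+ 2 (s + q) r) (≰⇒> 2n≰3m))

  ⌈m/3⌉≤ : ∀ {m k} → m ≤ 3 * k → ⌈ m /3⌉ ≤ k
  ⌈m/3⌉≤ {m} {k} m≤3k = s≤s⁻¹ (m<n*o⇒m/o<n (begin-strict
    m + 2      ≤⟨ +-monoˡ-≤ 2 m≤3k ⟩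
    3 * k + 2  <⟨ n<1+n _ ⟩
    suc (3 * k + 2) ≡⟨ shuffle k ⟩
    suc k * 3  ∎))
    where
    open ≤-Reasoning
    shuffle : ∀ m → suc (3 * m + 2) ≡ suc m * 3
    shuffle = solve-∀

open import Data.Nat using (ℕ; _≤_; _*_)
open import Data.Nat.Properties using (⌊n/2⌋+⌈n/2⌉≡n)
open UpperBound using (balanced-layout; 2n≤3⌈2n/3⌉)
open LowerBound using (2n≤3[s+q]; ⌈m/3⌉≤)

theorem4 : (n : ℕ) → 1 ≤ n → IsMixedSeparatedNumber n ⌈ 2 * n /3⌉
theorem4 n _ =
  (_ , _ , ⌊n/2⌋+⌈n/2⌉≡n ⌈ 2 * n /3⌉ , balanced-layout n ⌈ 2 * n /3⌉ (2n≤3⌈2n/3⌉ n)) ,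
  λ s q L → ⌈m/3⌉≤ (2n≤3[s+q] L)
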